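{- Let $n_1,\dots,n_m$ be positive integers, $N=n_1+\cdots+n_m$, and let $N_1,\dots,N_m$ be positive integers with $N_j\ge N-1$ for $j=1,\dots,m$. Define $Q(z)=\sum_{k=0}^N a_kz^k$ by $a_N=1$ and, for $k=0,1,\dots,N-1$, \[ a_{N-k-1}=\sum_{\ell=k}^{N-1}(-1)^{\ell+1}\frac{(\alpha_0-1)_{\ell-k}}{(\ell-k)!}\,\frac{(\alpha_0+\ell+1)_{N-\ell-1}}{(N-\ell-1)!}\prod_{j=1}^m\frac{(\alpha_j+\alpha_0+N_j-N+\ell+1)_{n_j}}{(\alpha_j+N_j-N+1)_{n_j}}, \] and for $j=1,\dots,m$ define $P_j(z)=\sum_{\mu=0}^{N_j}c_{j\mu}z^\mu$ with \[ c_{j\mu}=\sum_{k=0}^{\min\{N,\mu\}}a_k\frac{(\alpha_j)_{\mu-k}}{(\alpha_j+\alpha_0)_{\mu-k}}. \] Then $Q\neq0$, $\deg Q\le N$, $\deg P_j\le N_j$, and, as formal power series in $\mathbb{Q}[[z]]$, $\operatorname{ord}_{z=0}\big(Q(z)\varphi_j(z)-P_j(z)\big)\ge N_j+n_j+1$ for $j=1,\dots,m$. That is, $Q,P_1,\dots,P_m$ are type $(N;N_1,\dots,N_m)$ Padé approximation polynomials of the second kind for $\varphi_1,\dots,\varphi_m$.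
   Context: Let $m\ge1$ and let $\alpha_0,\alpha_1,\dots,\alpha_m$ be positive rational numbers with $\alpha_i-\alpha_j\notin\mathbb{Z}$ for $1\le i<j\le m$. Pochhammer symbol: $(x)_0=1$, $(x)_n=x(x+1)\cdots(x+n-1)$ for $n\ge1$. Define the formal power series $\varphi_j(z)=\sum_{n=0}^\infty\frac{(\alpha_j)_n}{(\alpha_j+\alpha_0)_n}z^n$, $j=1,\dots,m$. $\operatorname{ord}$ denotes the order of vanishing at $z=0$. Polynomials $Q\ne0,P_1,\dots,P_m$ are called type $(N;N_1,\dots,N_m)$ Padé approximation polynomials of the second kind for $\varphi_1,\dots,\varphi_m$ if $\deg Q\le N$, $\deg P_j\le N_j$ and $\operatorname{ord}(Q\varphi_j-P_j)\ge N_j+n_j+1$ for all $j$. -}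

module Defs where

open import Algebra.Bundles using (CommutativeRing)
import Algebra.Properties.CommutativeMonoid.Sum as Sum
import Algebra.Properties.Semiring.Exp as Exp
open import Data.Fin.Base using (Fin; toℕ)
import Data.Integer.Base as ℤ
import Data.Integer.Properties as ℤ
open import Data.Nat.Base as ℕ using (ℕ; zero; suc; _∸_; _!)
import Data.Nat.Properties as ℕ
open import Data.Rational.Base
open import Data.Rational.Literals using (fromℤ)
open import Data.Rational.Properties
open import Data.Rational.Solver using (module +-*-Solver)
open import Relation.Binary.PropositionalEquality
  using (_≡_; refl; sym; trans; cong; subst)
open import Relation.Nullary using (¬_; yes; no)

open Sum +-0-commutativeMonoid public using (sum-syntax; sum⁺-syntax)
open Sum *-1-commutativeMonoid public using () renaming (sum to ∏)
open Sum ℕ.+-0-commutativeMonoid public using () renaming (sum to ∑ℕ)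
open Exp (CommutativeRing.semiring +-*-commutativeRing) public using (_^_)

fromℕ : ℕ → ℚ
fromℕ n = fromℤ (ℤ.+ n)

-- Sum of f ℓ over k ≤ ℓ ≤ N - 1.
∑from : (k N : ℕ) → (ℕ → ℚ) → ℚ
∑from k N f = ∑[ i < N ∸ k ] f (k ℕ.+ toℕ i)

poch : ℚ → ℕ → ℚ
poch x zero    = 1ℚ
poch x (suc n) = poch x n * (x + fromℕ n)

-- A power series is its sequence of coefficients; a polynomial is a power
-- series satisfying Degree≤ d for some d.
PowerSeries : Set
PowerSeries = ℕ → ℚ

infixl 7 _⊛_
infixl 6 _⊖_

_⊛_ : PowerSeries → PowerSeries → PowerSeries
(f ⊛ g) μ = ∑[ k ≤ μ ] (f (toℕ k) * g (μ ∸ toℕ k))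

_⊖_ : PowerSeries → PowerSeries → PowerSeries
(f ⊖ g) μ = f μ - g μ

IsZero : PowerSeries → Set
IsZero f = ∀ μ → f μ ≡ 0ℚ

Degree≤ : ℕ → PowerSeries → Set
Degree≤ d f = ∀ μ → d ℕ.< μ → f μ ≡ 0ℚ

Order≥ : ℕ → PowerSeries → Set
Order≥ r f = ∀ μ → μ ℕ.< r → f μ ≡ 0ℚ

-- The polynomial with coefficients c 0, …, c d.
polynomial : (d : ℕ) → (ℕ → ℚ) → PowerSeries
polynomial d c μ with μ ℕ.≤? d
... | yes _ = c μ
... | no  _ = 0ℚ

record IsPadéSecondKind {m : ℕ} (φ : Fin m → PowerSeries)
                        (N : ℕ) (Ns n : Fin m → ℕ)
                        (Q : PowerSeries) (P : Fin m → PowerSeries) : Set where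
  field
    Q≢0     : ¬ IsZero Q
    degreeQ : Degree≤ N Q
    degreeP : ∀ j → Degree≤ (Ns j) (P j)
    order   : ∀ j → Order≥ (Ns j ℕ.+ n j ℕ.+ 1) (Q ⊛ φ j ⊖ P j)

-- The remaining lemmas before the approximants justify the divisions there.

fromℕ-suc : ∀ n → fromℕ (suc n) ≡ fromℕ n + 1ℚ
fromℕ-suc n = toℚᵘ-injective (begin
  toℚᵘ (fromℕ (suc n))           ≡⟨ cong (λ k → mkℚᵘ k 0) lemma ⟩
  toℚᵘ (fromℕ n) ℚᵘ.+ toℚᵘ 1ℚ    ≈⟨ toℚᵘ-homo-+ (fromℕ n) 1ℚ ⟨
  toℚᵘ (fromℕ n + 1ℚ)            ∎)
  where
  open import Data.Rational.Unnormalised.Base as ℚᵘ using (mkℚᵘ)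
  open import Data.Rational.Unnormalised.Properties as ℚᵘ using (module ≃-Reasoning)
  open ≃-Reasoning
  lemma : ℤ.+ suc n ≡ ℤ.+ n ℤ.* ℤ.+ 1 ℤ.+ ℤ.+ 1
  lemma rewrite ℤ.*-identityʳ (ℤ.+ n) | ℕ.+-comm n 1 = refl

fromℕ-mono-≤ : ∀ {k l} → k ℕ.≤ l → fromℕ k ≤ fromℕ l
fromℕ-mono-≤ k≤l = *≤* (ℤ.*-monoʳ-≤-nonNeg (ℤ.+ 1) (ℤ.+≤+ k≤l))

x+n>0 : ∀ {x} → 0ℚ < x → ∀ n → 0ℚ < x + fromℕ n
x+n>0 x>0 n = +-mono-<-≤ x>0 (fromℕ-mono-≤ {0} {n} ℕ.z≤n)

poch>0 : ∀ {x} → 0ℚ < x → ∀ n → 0ℚ < poch x n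
poch>0         x>0 zero    = positive⁻¹ 1ℚ
poch>0 {x = x} x>0 (suc n) = positive⁻¹ (poch x (suc n))
  {{pos*pos⇒pos (poch x n)      {{positive (poch>0 x>0 n)}}
                (x + fromℕ n)   {{positive (x+n>0 x>0 n)}}}}

poch≢0 : ∀ {x} → 0ℚ < x → ∀ n → NonZero (poch x n)
poch≢0 {x} x>0 n = pos⇒nonZero (poch x n) {{positive (poch>0 x>0 n)}}

factorial≢0 : ∀ n → NonZero (fromℕ (n !))
factorial≢0 n = pos⇒nonZero (fromℕ (n !))
  {{positive (<-≤-trans (positive⁻¹ 1ℚ) (fromℕ-mono-≤ (ℕ.1≤n! n)))}}

x+y>0 : ∀ {x y} → 0ℚ < x → 0ℚ < y → 0ℚ < x + y
x+y>0 = +-mono-<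

shift>0 : ∀ {x} → 0ℚ < x → ∀ N M → N ∸ 1 ℕ.≤ M →
          0ℚ < x + fromℕ M - fromℕ N + 1ℚ
shift>0 {x} x>0 N M N∸1≤M = subst (0ℚ <_) (sym eq)
  (<-≤-trans x>0 (≤-trans (≤-reflexive (sym (+-identityʳ x)))
    (+-monoʳ-≤ x (≤-trans (≤-reflexive (sym (+-inverseʳ (fromℕ N))))
      (+-monoˡ-≤ (- fromℕ N) (fromℕ-mono-≤ N≤1+M))))))
  where
  open +-*-Solver
  N≤1+M : N ℕ.≤ suc M
  N≤1+M = ℕ.≤-trans (ℕ.m≤n+m∸n N 1) (ℕ.s≤s N∸1≤M)
  shuffle : ∀ y z o → x + y - z + o ≡ x + (y + o - z)
  shuffle y z o = solve 4
    (λ x y z o → x :+ y :- z :+ o := x :+ (y :+ o :- z)) refl x y z o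
  eq : x + fromℕ M - fromℕ N + 1ℚ ≡ x + (fromℕ (suc M) - fromℕ N)
  eq = trans (shuffle (fromℕ M) (fromℕ N) 1ℚ)
             (cong (λ y → x + (y - fromℕ N)) (sym (fromℕ-suc M)))

module Approximants {m : ℕ}
  (α₀ : ℚ) (α : Fin m → ℚ) .(α₀>0 : 0ℚ < α₀) .(α>0 : ∀ j → 0ℚ < α j)
  (n Ns : Fin m → ℕ) .(N∸1≤Ns : ∀ j → ∑ℕ n ∸ 1 ℕ.≤ Ns j)
  where

  N : ℕ
  N = ∑ℕ n

  φ : Fin m → PowerSeries
  φ j i = (poch (α j) i ÷ poch (α j + α₀) i)
            {{poch≢0 (x+y>0 (α>0 j) α₀>0) i}}

  -- reversed k is the coefficient a_{N-k-1}, for k < N.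
  reversed : ℕ → ℚ
  reversed k = ∑from k N λ ℓ →
      (- 1ℚ) ^ (ℓ ℕ.+ 1)
    * (poch (α₀ - 1ℚ) (ℓ ∸ k) ÷ fromℕ ((ℓ ∸ k) !)) {{factorial≢0 (ℓ ∸ k)}}
    * (poch (α₀ + fromℕ ℓ + 1ℚ) (N ∸ ℓ ∸ 1) ÷ fromℕ ((N ∸ ℓ ∸ 1) !))
        {{factorial≢0 (N ∸ ℓ ∸ 1)}}
    * ∏ λ j →
        (poch (α j + α₀ + fromℕ (Ns j) - fromℕ N + fromℕ ℓ + 1ℚ) (n j)
          ÷ poch (α j + fromℕ (Ns j) - fromℕ N + 1ℚ) (n j))
          {{poch≢0 (shift>0 (α>0 j) N (Ns j) (N∸1≤Ns j)) (n j)}}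

  -- Only the values at k ≤ N matter.
  a : ℕ → ℚ
  a k with k ℕ.<? N
  ... | yes _ = reversed (N ∸ k ∸ 1)
  ... | no  _ = 1ℚ

  Q : PowerSeries
  Q = polynomial N a

  c : Fin m → ℕ → ℚ
  c j μ = ∑[ k ≤ N ℕ.⊓ μ ]
    (a (toℕ k) * (poch (α j) (μ ∸ toℕ k) ÷ poch (α j + α₀) (μ ∸ toℕ k))
                   {{poch≢0 (x+y>0 (α>0 j) α₀>0) (μ ∸ toℕ k)}})

  P : Fin m → PowerSeries
  P j = polynomial (Ns j) (c j)

{-# OPTIONS --safe #-}
module Submission where

-- For N_j < μ ≤ N_j + n_j put x = α_j + μ - N.  After multiplication by
-- (α_j+α₀)_μ the coefficient of z^μ in Q φ_j becomes (α_j)_{μ-N} R(x), where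
--   R(x) = ∑_{k ≤ N} a_{N-k} (x)_k (x+α₀+k)_{N-k}.
-- A Saalschütz summation over k shows that R is the Lagrange interpolant, at
-- the nodes 0 and -α₀-ℓ (0 ≤ ℓ < N), of (α₀)_N D(x) with
--   D(x) = ∏_j (α_j+N_j-N+1-x)_{n_j} / (α_j+N_j-N+1)_{n_j}.
-- Since D has degree N, R = (α₀)_N D, which vanishes at the values of x above.

open import Defs
open import Algebra.Bundles using (CommutativeRing)
import Algebra.Properties.CommutativeMonoid.Sum as Sum
import Algebra.Properties.Semiring.Sum as SemiringSum
open import Data.Empty using (⊥-elim)
open import Data.Fin.Base as Fin using (Fin; zero; suc; toℕ)
import Data.Fin.Permutation as Perm
import Data.Fin.Properties as Fin
open import Data.Integer.Base using (ℤ)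
open import Data.Nat.Base as ℕ using (ℕ; zero; suc; _∸_; _!; z≤n; s≤s)
import Data.Nat.Properties as ℕ
open import Data.Product.Base using (∃; _×_; _,_; proj₂)
open import Data.Rational.Base
open import Data.Rational.Literals using (fromℤ)
open import Data.Rational.Properties
open import Data.Rational.Solver using (module +-*-Solver)
open import Data.Sum.Base using (inj₁; inj₂)
open import Data.Vec.Functional using (removeAt)
open import Function.Base using (_∘_; _$_)
open import Function.Definitions using (Injective)
open import Relation.Binary.Definitions using (tri<; tri≈; tri>)
open import Relation.Binary.PropositionalEquality
open import Relation.Nullary using (Dec; yes; no)
open import Relation.Nullary.Decidable using (dec-yes; dec-no)

open Sum +-0-commutativeMonoid
  using (∑-distrib-+; sum-cong-≗; sum-replicate-zero; sum-remove; sum-permute)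
open Sum *-1-commutativeMonoid using () renaming (sum-cong-≗ to ∏-cong-≗)
open SemiringSum (CommutativeRing.semiring +-*-commutativeRing)
  using (*-distribˡ-sum; *-distribʳ-sum)
open +-*-Solver using (solve; con; _:=_; _:+_; _:*_; _:-_; :-_)
open ≡-Reasoning

-- The formula for `a` is interpolation read backwards. The required vanishing prescribes zeros of
-- R, namely those of D, so the a_{N-k} should be the coordinates of (α₀)_N D in the products (x)_k
-- (x+α₀+k)_{N-k}. The nodes are chosen to make these coordinates accessible: at x = 0 only the
-- product with k = 0 survives, so that a_N = 1 amounts to D(0) = 1; at x = -α₀-ℓ the products with
-- k ≤ ℓ vanish, so the system is triangular. This is why ℓ runs from k to N-1 in the definition of
-- a_{N-k-1}. In that definition the product over j is D(-α₀-ℓ), the sign and the second quotient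
-- come from normalising the Lagrange basis, and (α₀-1)_{ℓ-k}/(ℓ-k)! is the change of basis from
-- these products to the Lagrange basis. The Saalschütz summation verifies this change of basis one
-- ℓ at a time, so no double sum ever has to be evaluated at a node.

-- Arithmetic of rational numbers

x-y≡0⇒x≡y : ∀ x y → x - y ≡ 0ℚ → x ≡ y
x-y≡0⇒x≡y x y eq = begin
  x            ≡⟨ solve 2 (λ x y → x := (x :- y) :+ y) refl x y ⟩
  (x - y) + y  ≡⟨ cong (_+ y) eq ⟩
  0ℚ + y       ≡⟨ +-identityˡ y ⟩
  y            ∎

x*y≡0⇒y≡0 : ∀ x {y} .{{_ : NonZero x}} → x * y ≡ 0ℚ → y ≡ 0ℚ
x*y≡0⇒y≡0 x {y} eq = begin
  y             ≡⟨ *-identityˡ y ⟨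
  1ℚ * y        ≡⟨ cong (_* y) (*-inverseˡ x) ⟨
  1/ x * x * y  ≡⟨ *-assoc (1/ x) x y ⟩
  1/ x * (x * y) ≡⟨ cong (1/ x *_) eq ⟩
  1/ x * 0ℚ     ≡⟨ *-zeroʳ (1/ x) ⟩
  0ℚ            ∎

÷-*-cancel : ∀ x y .{{_ : NonZero y}} → (x ÷ y) * y ≡ x
÷-*-cancel x y = begin
  x * 1/ y * y   ≡⟨ *-assoc x (1/ y) y ⟩
  x * (1/ y * y) ≡⟨ cong (x *_) (*-inverseˡ y) ⟩
  x * 1ℚ         ≡⟨ *-identityʳ x ⟩
  x              ∎

>0⇒≢0 : ∀ {x} → 0ℚ < x → x ≢ 0ℚ
>0⇒≢0 x>0 refl = <-irrefl refl x>0

fromℕ-+ : ∀ k l → fromℕ (k ℕ.+ l) ≡ fromℕ k + fromℕ l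
fromℕ-+ zero    l = sym (+-identityˡ (fromℕ l))
fromℕ-+ (suc k) l = begin
  fromℕ (suc (k ℕ.+ l))      ≡⟨ fromℕ-suc (k ℕ.+ l) ⟩
  fromℕ (k ℕ.+ l) + 1ℚ       ≡⟨ cong (_+ 1ℚ) (fromℕ-+ k l) ⟩
  fromℕ k + fromℕ l + 1ℚ
    ≡⟨ solve 2 (λ x y → x :+ y :+ con 1ℚ := x :+ con 1ℚ :+ y) refl (fromℕ k) (fromℕ l) ⟩
  fromℕ k + 1ℚ + fromℕ l     ≡⟨ cong (_+ fromℕ l) (fromℕ-suc k) ⟨
  fromℕ (suc k) + fromℕ l    ∎

fromℕ-* : ∀ k l → fromℕ (k ℕ.* l) ≡ fromℕ k * fromℕ l
fromℕ-* zero    l = sym (*-zeroˡ (fromℕ l))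
fromℕ-* (suc k) l = begin
  fromℕ (l ℕ.+ k ℕ.* l)        ≡⟨ fromℕ-+ l (k ℕ.* l) ⟩
  fromℕ l + fromℕ (k ℕ.* l)    ≡⟨ cong (fromℕ l +_) (fromℕ-* k l) ⟩
  fromℕ l + fromℕ k * fromℕ l
    ≡⟨ solve 2 (λ x y → y :+ x :* y := (x :+ con 1ℚ) :* y) refl (fromℕ k) (fromℕ l) ⟩
  (fromℕ k + 1ℚ) * fromℕ l     ≡⟨ cong (_* fromℕ l) (fromℕ-suc k) ⟨
  fromℕ (suc k) * fromℕ l      ∎

fromℕ-injective : ∀ {k l} → fromℕ k ≡ fromℕ l → k ≡ l
fromℕ-injective refl = refl

-- Pochhammer symbols

poch-front : ∀ x n → poch x (suc n) ≡ x * poch (x + 1ℚ) n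
poch-front x zero    = solve 1 (λ x → con 1ℚ :* (x :+ con 0ℚ) := x :* con 1ℚ) refl x
poch-front x (suc n) = begin
  poch x (suc n) * (x + fromℕ (suc n))
    ≡⟨ cong₂ _*_ (poch-front x n) (cong (x +_) (fromℕ-suc n)) ⟩
  x * poch (x + 1ℚ) n * (x + (fromℕ n + 1ℚ))
    ≡⟨ solve 3 (λ x p k → x :* p :* (x :+ (k :+ con 1ℚ)) := x :* (p :* (x :+ con 1ℚ :+ k)))
        refl x (poch (x + 1ℚ) n) (fromℕ n) ⟩
  x * (poch (x + 1ℚ) n * (x + 1ℚ + fromℕ n))       ∎

poch-+ : ∀ x k l → poch x (k ℕ.+ l) ≡ poch x k * poch (x + fromℕ k) l
poch-+ x zero    l = sym (trans (*-identityˡ _) (cong (λ y → poch y l) (+-identityʳ x)))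
poch-+ x (suc k) l = begin
  poch x (suc (k ℕ.+ l))                                ≡⟨ poch-front x (k ℕ.+ l) ⟩
  x * poch (x + 1ℚ) (k ℕ.+ l)                           ≡⟨ cong (x *_) (poch-+ (x + 1ℚ) k l) ⟩
  x * (poch (x + 1ℚ) k * poch (x + 1ℚ + fromℕ k) l)     ≡⟨ *-assoc x _ _ ⟨
  x * poch (x + 1ℚ) k * poch (x + 1ℚ + fromℕ k) l
    ≡⟨ cong₂ _*_ (sym (poch-front x k)) (cong (λ y → poch y l) shift) ⟩
  poch x (suc k) * poch (x + fromℕ (suc k)) l           ∎
  where
  shift : x + 1ℚ + fromℕ k ≡ x + fromℕ (suc k)
  shift = trans (solve 2 (λ x k → x :+ con 1ℚ :+ k := x :+ (k :+ con 1ℚ)) refl x (fromℕ k))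
                (cong (x +_) (sym (fromℕ-suc k)))

poch-root : ∀ x {i n} → i ℕ.< n → x + fromℕ i ≡ 0ℚ → poch x n ≡ 0ℚ
poch-root x {i} {suc n} i<1+n eq with ℕ.m≤n⇒m<n∨m≡n (ℕ.≤-pred i<1+n)
... | inj₁ i<n  = trans (cong (_* (x + fromℕ n)) (poch-root x i<n eq)) (*-zeroˡ (x + fromℕ n))
... | inj₂ refl = trans (cong (poch x n *_) eq) (*-zeroʳ (poch x n))

poch-1 : ∀ n → poch 1ℚ n ≡ fromℕ (n !)
poch-1 zero    = refl
poch-1 (suc n) = begin
  poch 1ℚ n * (1ℚ + fromℕ n)        ≡⟨ cong₂ _*_ (poch-1 n) (+-comm 1ℚ (fromℕ n)) ⟩
  fromℕ (n !) * (fromℕ n + 1ℚ)      ≡⟨ cong (fromℕ (n !) *_) (fromℕ-suc n) ⟨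
  fromℕ (n !) * fromℕ (suc n)       ≡⟨ *-comm (fromℕ (n !)) (fromℕ (suc n)) ⟩
  fromℕ (suc n) * fromℕ (n !)       ≡⟨ fromℕ-* (suc n) (n !) ⟨
  fromℕ (suc n !)                   ∎

poch-negative : ∀ n → poch (- fromℕ n) n ≡ (- 1ℚ) ^ n * fromℕ (n !)
poch-negative zero    = refl
poch-negative (suc n) = begin
  poch (- fromℕ (suc n)) (suc n)                       ≡⟨ poch-front _ n ⟩
  - fromℕ (suc n) * poch (- fromℕ (suc n) + 1ℚ) n
    ≡⟨ cong (λ y → - fromℕ (suc n) * poch y n) shift ⟩
  - fromℕ (suc n) * poch (- fromℕ n) n
    ≡⟨ cong (- fromℕ (suc n) *_) (poch-negative n) ⟩
  - fromℕ (suc n) * ((- 1ℚ) ^ n * fromℕ (n !))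
    ≡⟨ solve 3 (λ k s f → :- k :* (s :* f) := :- con 1ℚ :* s :* (k :* f))
        refl (fromℕ (suc n)) ((- 1ℚ) ^ n) (fromℕ (n !)) ⟩
  - 1ℚ * (- 1ℚ) ^ n * (fromℕ (suc n) * fromℕ (n !))
    ≡⟨ cong ((- 1ℚ) ^ suc n *_) (fromℕ-* (suc n) (n !)) ⟨
  (- 1ℚ) ^ suc n * fromℕ (suc n !)                     ∎
  where
  shift : - fromℕ (suc n) + 1ℚ ≡ - fromℕ n
  shift = trans (cong (λ k → - k + 1ℚ) (fromℕ-suc n))
                (solve 1 (λ k → :- (k :+ con 1ℚ) :+ con 1ℚ := :- k) refl (fromℕ n))

-- Polynomial functions and their zeros

-- Polynomial functions of degree at most d, presented by iterated synthetic
-- division so that no coefficients are needed.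
Polynomial : ℕ → (ℚ → ℚ) → Set
Polynomial zero    f = ∀ x y → f x ≡ f y
Polynomial (suc d) f =
  ∀ r → ∃ λ g → Polynomial d g × (∀ x → f x ≡ f r + (x - r) * g x)

Polynomial-resp-≗ : ∀ d {f g} → f ≗ g → Polynomial d f → Polynomial d g
Polynomial-resp-≗ zero    f≗g F x y = trans (sym (f≗g x)) (trans (F x y) (f≗g y))
Polynomial-resp-≗ (suc d) f≗g F r with q , Q , eq ← F r =
  q , Q , λ x → trans (sym (f≗g x)) (trans (eq x) (cong (_+ (x - r) * q x) (f≗g r)))

Polynomial-const : ∀ d c → Polynomial d (λ _ → c)
Polynomial-const zero    c _ _ = refl
Polynomial-const (suc d) c r = (λ _ → 0ℚ) , Polynomial-const d 0ℚ ,
  λ x → solve 3 (λ c x r → c := c :+ (x :- r) :* con 0ℚ) refl c x r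

Polynomial-weaken : ∀ d {f} → Polynomial d f → Polynomial (suc d) f
Polynomial-weaken zero {f} F r = (λ _ → 0ℚ) , Polynomial-const 0 0ℚ ,
  λ x → trans (F x r) (solve 3 (λ c x r → c := c :+ (x :- r) :* con 0ℚ) refl (f r) x r)
Polynomial-weaken (suc d) F r with q , Q , eq ← F r = q , Polynomial-weaken d Q , eq

Polynomial-weaken-+ : ∀ d e {f} → Polynomial e f → Polynomial (d ℕ.+ e) f
Polynomial-weaken-+ zero    e F = F
Polynomial-weaken-+ (suc d) e F = Polynomial-weaken (d ℕ.+ e) (Polynomial-weaken-+ d e F)

Polynomial-+ : ∀ d {f g} → Polynomial d f → Polynomial d g → Polynomial d (λ x → f x + g x)
Polynomial-+ zero            F G x y = cong₂ _+_ (F x y) (G x y)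
Polynomial-+ (suc d) {f} {g} F G r with p , P , eq ← F r | q , Q , eq′ ← G r =
  (λ x → p x + q x) , Polynomial-+ d P Q , λ x → trans (cong₂ _+_ (eq x) (eq′ x))
    (solve 5 (λ a b t p q → (a :+ t :* p) :+ (b :+ t :* q) := (a :+ b) :+ t :* (p :+ q))
       refl (f r) (g r) (x - r) (p x) (q x))

Polynomial-scale : ∀ d c {f} → Polynomial d f → Polynomial d (λ x → c * f x)
Polynomial-scale zero    c F x y = cong (c *_) (F x y)
Polynomial-scale (suc d) c {f} F r with q , Q , eq ← F r =
  (λ x → c * q x) , Polynomial-scale d c Q , λ x → trans (cong (c *_) (eq x))
    (solve 4 (λ c a t q → c :* (a :+ t :* q) := c :* a :+ t :* (c :* q)) refl c (f r) (x - r) (q x))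

Polynomial-* : ∀ d e {f g} → Polynomial d f → Polynomial e g →
               Polynomial (d ℕ.+ e) (λ x → f x * g x)
Polynomial-* zero e {f} {g} F G = Polynomial-resp-≗ e (λ x → cong (_* g x) (F 0ℚ x))
                                    (Polynomial-scale e (f 0ℚ) G)
-- Product rule for difference quotients: fg - f(r)g(r) = (x-r)(f(r)q + pg). `G` is weakened first
-- so that the quotient `q` exists, with degree at most `e`, even when `e` is 0.
Polynomial-* (suc d) e {f} {g} F G r
  with p , P , eq ← F r | q , Q , eq′ ← Polynomial-weaken e G r =
  (λ x → f r * q x + p x * g x) ,
  Polynomial-+ (d ℕ.+ e) (Polynomial-scale (d ℕ.+ e) (f r) (Polynomial-weaken-+ d e Q))
                         (Polynomial-* d e P G) ,
  λ x → begin
    f x * g x                                            ≡⟨ cong (_* g x) (eq x) ⟩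
    (f r + (x - r) * p x) * g x
      ≡⟨ solve 4 (λ a t p g → (a :+ t :* p) :* g := a :* g :+ t :* p :* g)
          refl (f r) (x - r) (p x) (g x) ⟩
    f r * g x + (x - r) * p x * g x
      ≡⟨ cong (λ y → f r * y + (x - r) * p x * g x) (eq′ x) ⟩
    f r * (g r + (x - r) * q x) + (x - r) * p x * g x
      ≡⟨ solve 6 (λ a b t q p g → a :* (b :+ t :* q) :+ t :* p :* g := a :* b :+ t :* (a :* q :+ p :* g))
          refl (f r) (g r) (x - r) (q x) (p x) (g x) ⟩
    f r * g r + (x - r) * (f r * q x + p x * g x)        ∎

Polynomial-affine : ∀ u b → Polynomial 1 (λ x → u * x + b)
Polynomial-affine u b r = (λ _ → u) , (λ _ _ → refl) ,
  λ x → solve 4 (λ u x b r → u :* x :+ b := u :* r :+ b :+ (x :- r) :* u) refl u x b r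

-- The slope `u` is a parameter because both signs occur: 1 in the interpolation basis and -1 in the
-- factors of `D`.
Polynomial-poch : ∀ u b n → Polynomial n (λ x → poch (u * x + b) n)
Polynomial-poch u b zero    _ _ = refl
Polynomial-poch u b (suc n) = Polynomial-resp-≗ (suc n) eq
  (Polynomial-* 1 n (Polynomial-affine u b) (Polynomial-poch u (b + 1ℚ) n))
  where
  eq : ∀ x → (u * x + b) * poch (u * x + (b + 1ℚ)) n ≡ poch (u * x + b) (suc n)
  eq x = trans (cong (λ y → (u * x + b) * poch y n) (sym (+-assoc (u * x) b 1ℚ)))
               (sym (poch-front (u * x + b) n))

Polynomial-∑ : ∀ d {n} (f : Fin n → ℚ → ℚ) → (∀ i → Polynomial d (f i)) →
               Polynomial d (λ x → ∑[ i < n ] f i x)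
Polynomial-∑ d {zero}  f F = Polynomial-const d 0ℚ
Polynomial-∑ d {suc n} f F = Polynomial-+ d (F zero) (Polynomial-∑ d (f ∘ suc) (F ∘ suc))

Polynomial-∏ : ∀ {m} (n : Fin m → ℕ) (f : Fin m → ℚ → ℚ) → (∀ j → Polynomial (n j) (f j)) →
               Polynomial (∑ℕ n) (λ x → ∏ λ j → f j x)
Polynomial-∏ {zero}  n f F = Polynomial-const 0 1ℚ
Polynomial-∏ {suc m} n f F =
  Polynomial-* (n zero) _ (F zero) (Polynomial-∏ (n ∘ suc) (f ∘ suc) (F ∘ suc))

-- Dividing by the linear factor of the first zero lowers the degree by one, and the other points,
-- being different from it, stay zeros of the quotient. This supplies the uniqueness of
-- interpolation.
Polynomial-zero : ∀ d {f} → Polynomial d f → (z : Fin (suc d) → ℚ) → Injective _≡_ _≡_ z →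
                  (∀ i → f (z i) ≡ 0ℚ) → ∀ x → f x ≡ 0ℚ
Polynomial-zero zero    F z inj fz≡0 x = trans (F x (z zero)) (fz≡0 zero)
Polynomial-zero (suc d) {f} F z inj fz≡0 x with q , Q , eq ← F (z zero) = begin
  f x          ≡⟨ factor x ⟩
  (x - z zero) * q x
    ≡⟨ cong ((x - z zero) *_) (Polynomial-zero d Q (z ∘ suc) (Fin.suc-injective ∘ inj) qz≡0 x) ⟩
  (x - z zero) * 0ℚ   ≡⟨ *-zeroʳ (x - z zero) ⟩
  0ℚ ∎
  where
  factor : ∀ x → f x ≡ (x - z zero) * q x
  factor x = trans (eq x) (trans (cong (_+ (x - z zero) * q x) (fz≡0 zero)) (+-identityˡ _))
  qz≡0 : ∀ i → q (z (suc i)) ≡ 0ℚ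
  qz≡0 i = x*y≡0⇒y≡0 (z (suc i) - z zero)
    {{≢-nonZero (λ e → Fin.0≢1+n (sym (inj (x-y≡0⇒x≡y (z (suc i)) (z zero) e))))}}
    (trans (sym (factor (z (suc i)))) (fz≡0 (suc i)))

-- Finite sums and products

∑-triangle : ∀ N (g : ℕ → ℕ → ℚ) →
  ∑[ k < N ] ∑from (toℕ k) N (g (toℕ k)) ≡
  ∑[ ℓ < N ] ∑[ k ≤ toℕ ℓ ] g (toℕ k) (toℕ ℓ)
∑-triangle zero    g = refl
∑-triangle (suc N) g = begin
  first + ∑[ k < N ] ∑from (toℕ k) N (g⁺ (toℕ k))
    ≡⟨ cong (first +_) (∑-triangle N g⁺) ⟩
  first + ∑[ ℓ < N ] ∑[ k ≤ toℕ ℓ ] g⁺ (toℕ k) (toℕ ℓ)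
    -- The value of `rest` at ℓ = 0 is an empty sum, so it can be prepended to complete the range to
    -- ℓ < N + 1.
    ≡⟨ cong (first +_) (+-identityˡ (∑[ ℓ < N ] rest (suc ℓ))) ⟨
  first + ∑[ ℓ < suc N ] rest ℓ
    ≡⟨ ∑-distrib-+ {suc N} (g 0 ∘ toℕ) rest ⟨
  ∑[ ℓ < suc N ] ∑[ k ≤ toℕ ℓ ] g (toℕ k) (toℕ ℓ) ∎
  where
  g⁺ : ℕ → ℕ → ℚ
  g⁺ k ℓ = g (suc k) (suc ℓ)
  first = ∑[ ℓ < suc N ] g 0 (toℕ ℓ)
  rest : Fin (suc N) → ℚ
  rest ℓ = ∑[ k < toℕ ℓ ] g (suc (toℕ k)) (toℕ ℓ)

∑-zero : ∀ {n} (f : Fin n → ℚ) → (∀ i → f i ≡ 0ℚ) → ∑[ i < n ] f i ≡ 0ℚ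
∑-zero {n} f f≡0 = trans (sum-cong-≗ f≡0) (sum-replicate-zero n)

∑-single : ∀ {n} (f : Fin n → ℚ) i → (∀ j → j ≢ i → f j ≡ 0ℚ) → ∑[ j < n ] f j ≡ f i
∑-single {suc n} f i others = begin
  ∑[ j < suc n ] f j                       ≡⟨ sum-remove {n} {i} f ⟩
  f i + ∑[ j < n ] removeAt f i j
    ≡⟨ cong (f i +_) (∑-zero (removeAt f i) λ j → others (Fin.punchIn i j) (Fin.punchInᵢ≢i i j)) ⟩
  f i + 0ℚ                                 ≡⟨ +-identityʳ (f i) ⟩
  f i                                      ∎

∑-truncate : ∀ {M N} (f : ℕ → ℚ) → M ℕ.≤ N → (∀ {k} → M ℕ.≤ k → k ℕ.< N → f k ≡ 0ℚ) →
             ∑[ k < N ] f (toℕ k) ≡ ∑[ k < M ] f (toℕ k)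
∑-truncate {N = N} f z≤n f≡0 = ∑-zero {N} (f ∘ toℕ) (λ k → f≡0 z≤n (Fin.toℕ<n k))
∑-truncate f (s≤s M≤N) f≡0 = cong (f 0 +_)
  (∑-truncate (f ∘ suc) M≤N (λ M≤k k<N → f≡0 (s≤s M≤k) (s≤s k<N)))

∑-reverse : ∀ N (f : ℕ → ℚ) → ∑[ k ≤ N ] f (toℕ k) ≡ ∑[ k ≤ N ] f (N ∸ toℕ k)
∑-reverse N f = trans (sum-permute {suc N} (f ∘ toℕ) Perm.reverse)
                      (sum-cong-≗ {suc N} (λ k → cong f (Fin.opposite-prop k)))

∏-zero : ∀ {n} (f : Fin n → ℚ) i → f i ≡ 0ℚ → ∏ f ≡ 0ℚ
∏-zero f zero    eq = trans (cong (_* ∏ (f ∘ suc)) eq) (*-zeroˡ (∏ (f ∘ suc)))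
∏-zero f (suc i) eq = trans (cong (f zero *_) (∏-zero (f ∘ suc) i eq)) (*-zeroʳ (f zero))

∏-one : ∀ {n} (f : Fin n → ℚ) → (∀ i → f i ≡ 1ℚ) → ∏ f ≡ 1ℚ
∏-one {zero}  f f≡1 = refl
∏-one {suc n} f f≡1 = cong₂ _*_ (f≡1 zero) (∏-one (f ∘ suc) (f≡1 ∘ suc))

-- Multiset coefficients and the Saalschütz summation

factorial⁻¹ : ℕ → ℚ
factorial⁻¹ n = (1/ fromℕ (n !)) {{factorial≢0 n}}

-- The coefficient of t^n in (1-t)^(-x); the quotients by factorials in the formula for `a` are of
-- this form.
multichoose : ℚ → ℕ → ℚ
multichoose x n = (poch x n ÷ fromℕ (n !)) {{factorial≢0 n}}

factorial⁻¹-suc : ∀ n → factorial⁻¹ n ≡ fromℕ (suc n) * factorial⁻¹ (suc n)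
factorial⁻¹-suc n = begin
  i                              ≡⟨ *-identityʳ i ⟨
  i * 1ℚ
    ≡⟨ cong (i *_) (*-inverseʳ (fromℕ (suc n !)) {{factorial≢0 (suc n)}}) ⟨
  i * (fromℕ (suc n !) * i⁺)     ≡⟨ cong (λ y → i * (y * i⁺)) (fromℕ-* (suc n) (n !)) ⟩
  i * (k * f * i⁺)
    ≡⟨ solve 4 (λ i k f i⁺ → i :* (k :* f :* i⁺) := i :* f :* (k :* i⁺)) refl i k f i⁺ ⟩
  i * f * (k * i⁺)               ≡⟨ cong (_* (k * i⁺)) (*-inverseˡ f {{factorial≢0 n}}) ⟩
  1ℚ * (k * i⁺)                  ≡⟨ *-identityˡ (k * i⁺) ⟩
  k * i⁺                         ∎
  where
  i = factorial⁻¹ n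
  i⁺ = factorial⁻¹ (suc n)
  k = fromℕ (suc n)
  f = fromℕ (n !)

-- An instance of the Pfaff–Saalschütz summation.
∑-multichoose-poch : ∀ a J y →
  ∑[ i ≤ J ] (multichoose (a - 1ℚ) (J ∸ toℕ i) * (poch y (toℕ i) * poch (y + a + fromℕ (toℕ i)) (J ∸ toℕ i)))
  ≡ poch (y + a - 1ℚ) J * multichoose a J
∑-multichoose-poch a zero    y = refl
∑-multichoose-poch a (suc J) y = begin
  multichoose (a - 1ℚ) (suc J) * (1ℚ * poch (y + a + 0ℚ) (suc J)) + ∑[ i ≤ J ] term (toℕ i)
    -- Every term with i ≥ 1 contains the factor y, and removing it leaves the same sum for J and y
    -- + 1. Hence y must stay general in the induction.
    ≡⟨ cong₂ _+_ (cong (λ z → multichoose (a - 1ℚ) (suc J) * (1ℚ * poch z (suc J))) (+-identityʳ (y + a)))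
                 (trans (sum-cong-≗ {suc J} (term≡ ∘ toℕ)) (sym (*-distribˡ-sum {suc J} y (term′ ∘ toℕ)))) ⟩
  multichoose (a - 1ℚ) (suc J) * (1ℚ * poch (y + a) (suc J)) + y * ∑[ i ≤ J ] term′ (toℕ i)
    ≡⟨ cong₂ (λ u v → u * i⁺ * (1ℚ * (p * (y + a + k))) + y * v) pred-front (∑-multichoose-poch a J (y + 1ℚ)) ⟩
  (a - 1ℚ) * q * i⁺ * (1ℚ * (p * (y + a + k))) + y * (poch (y + 1ℚ + a - 1ℚ) J * (q * factorial⁻¹ J))
    ≡⟨ cong₂ (λ u v → (a - 1ℚ) * q * i⁺ * (1ℚ * (p * (y + a + k))) + y * (poch u J * (q * v)))
         (solve 2 (λ y a → y :+ con 1ℚ :+ a :- con 1ℚ := y :+ a) refl y a)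
         (trans (factorial⁻¹-suc J) (cong (_* i⁺) (fromℕ-suc J))) ⟩
  (a - 1ℚ) * q * i⁺ * (1ℚ * (p * (y + a + k))) + y * (p * (q * ((k + 1ℚ) * i⁺)))
    -- Apart from the common factor p q i⁺ this is (a-1)(y+a+k) + y(k+1) = (y+a-1)(a+k).
    ≡⟨ solve 6 (λ a y k p q i → (a :- con 1ℚ) :* q :* i :* (con 1ℚ :* (p :* (y :+ a :+ k))) :+ y :* (p :* (q :* ((k :+ con 1ℚ) :* i)))
                             := (y :+ a :- con 1ℚ) :* p :* (q :* (a :+ k) :* i)) refl a y k p q i⁺ ⟩
  (y + a - 1ℚ) * p * (q * (a + k) * i⁺)
    ≡⟨ cong (λ z → (y + a - 1ℚ) * poch z J * multichoose a (suc J)) (cancel (y + a)) ⟨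
  (y + a - 1ℚ) * poch (y + a - 1ℚ + 1ℚ) J * multichoose a (suc J)
    ≡⟨ cong (_* multichoose a (suc J)) (poch-front (y + a - 1ℚ) J) ⟨
  poch (y + a - 1ℚ) (suc J) * multichoose a (suc J) ∎
  where
  k = fromℕ J
  p = poch (y + a) J
  q = poch a J
  i⁺ = factorial⁻¹ (suc J)
  cancel : ∀ x → x - 1ℚ + 1ℚ ≡ x
  cancel x = solve 1 (λ x → x :- con 1ℚ :+ con 1ℚ := x) refl x
  pred-front : poch (a - 1ℚ) (suc J) ≡ (a - 1ℚ) * q
  pred-front = trans (poch-front (a - 1ℚ) J) (cong (λ z → (a - 1ℚ) * poch z J) (cancel a))
  term term′ : ℕ → ℚ
  term i = multichoose (a - 1ℚ) (J ∸ i) * (poch y (suc i) * poch (y + a + fromℕ (suc i)) (J ∸ i))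
  term′ i = multichoose (a - 1ℚ) (J ∸ i) * (poch (y + 1ℚ) i * poch (y + 1ℚ + a + fromℕ i) (J ∸ i))
  term≡ : ∀ i → term i ≡ y * term′ i
  term≡ i = begin
    term i
      ≡⟨ cong₂ (λ u v → m * (u * poch v (J ∸ i))) (poch-front y i)
           (trans (cong (y + a +_) (fromℕ-suc i)) (solve 3 (λ y a i → y :+ a :+ (i :+ con 1ℚ) := y :+ con 1ℚ :+ a :+ i)
               refl y a (fromℕ i))) ⟩
    m * (y * u * v)
      ≡⟨ solve 4 (λ m y u v → m :* (y :* u :* v) := y :* (m :* (u :* v))) refl m y u v ⟩
    y * (m * (u * v)) ∎
    where
    m = multichoose (a - 1ℚ) (J ∸ i)
    u = poch (y + 1ℚ) i
    v = poch (y + 1ℚ + a + fromℕ i) (J ∸ i)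

suc[k]+[N∸k∸1]≡N : ∀ {k N} → k ℕ.< N → suc k ℕ.+ (N ∸ k ∸ 1) ≡ N
suc[k]+[N∸k∸1]≡N {k} {N} k<N =
  trans (cong (suc k ℕ.+_) (ℕ.pred[m∸n]≡m∸[1+n] N k)) (ℕ.m+[n∸m]≡n k<N)

sign² : ∀ n → (- 1ℚ) ^ n * (- 1ℚ) ^ n ≡ 1ℚ
sign² zero    = refl
sign² (suc n) = trans
  (solve 1 (λ s → :- con 1ℚ :* s :* (:- con 1ℚ :* s) := s :* s) refl ((- 1ℚ) ^ n)) (sign² n)

-- Interpolation at 0 and -a-ℓ

module Interpolation (a : ℚ) (a>0 : 0ℚ < a) (N : ℕ) (D : ℚ → ℚ)
                     (polynomial-D : Polynomial N D) (D[0]≡1 : D 0ℚ ≡ 1ℚ) where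

  node : ℕ → ℚ
  node ℓ = - (a + fromℕ ℓ)

  -- The factors of the summand of `coefficient k` that depend on ℓ alone.
  weight : ℕ → ℚ
  weight ℓ = (- 1ℚ) ^ (ℓ ℕ.+ 1) * multichoose (a + fromℕ ℓ + 1ℚ) (N ∸ ℓ ∸ 1) * D (node ℓ)

  -- The product x (x+a)_N without its factor x+a+ℓ, which is the Lagrange basis polynomial of
  -- `node ℓ` before normalisation.
  basis : ℕ → ℚ → ℚ
  basis ℓ x = x * (poch (x + a) ℓ * poch (x + a + fromℕ ℓ + 1ℚ) (N ∸ ℓ ∸ 1))

  -- The first summand is the Lagrange term of the node 0: it vanishes at each `node ℓ` with ℓ < N
  -- and equals (a)_N at 0. Scaling the whole interpolant by (a)_N spares this term a denominator.
  interpolant : ℚ → ℚ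
  interpolant x = poch (x + a) N + ∑[ ℓ < N ] (weight (toℕ ℓ) * multichoose a (toℕ ℓ) * basis (toℕ ℓ) x)

  polynomial-basis : ∀ {ℓ} → ℓ ℕ.< N → Polynomial N (basis ℓ)
  polynomial-basis {ℓ} ℓ<N = Polynomial-resp-≗ N eq
    (subst (λ d → Polynomial d f) (suc[k]+[N∸k∸1]≡N ℓ<N)
      (Polynomial-* 1 (ℓ ℕ.+ e) (Polynomial-affine 1ℚ 0ℚ)
        (Polynomial-* ℓ e (Polynomial-poch 1ℚ a ℓ) (Polynomial-poch 1ℚ (a + fromℕ ℓ + 1ℚ) e))))
    where
    e = N ∸ ℓ ∸ 1
    f : ℚ → ℚ
    f x = (1ℚ * x + 0ℚ) * (poch (1ℚ * x + a) ℓ * poch (1ℚ * x + (a + fromℕ ℓ + 1ℚ)) e)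
    eq : f ≗ basis ℓ
    eq x = cong₂ _*_ (solve 1 (λ x → con 1ℚ :* x :+ con 0ℚ := x) refl x)
      (cong₂ (λ u v → poch u ℓ * poch v e) (cong (_+ a) (*-identityˡ x))
        (solve 3 (λ x a k → con 1ℚ :* x :+ (a :+ k :+ con 1ℚ) := x :+ a :+ k :+ con 1ℚ)
            refl x a (fromℕ ℓ)))

  polynomial-interpolant : Polynomial N interpolant
  polynomial-interpolant = Polynomial-+ N
    (Polynomial-resp-≗ N (λ x → cong (λ y → poch (y + a) N) (*-identityˡ x)) (Polynomial-poch 1ℚ a N))
    (Polynomial-∑ N _ λ ℓ → Polynomial-scale N (weight (toℕ ℓ) * multichoose a (toℕ ℓ))
                              (polynomial-basis (Fin.toℕ<n ℓ)))

  node+a : ∀ ℓ → node ℓ + a ≡ - fromℕ ℓ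
  node+a ℓ = solve 2 (λ a k → :- (a :+ k) :+ a := :- k) refl a (fromℕ ℓ)

  -- The nodes before ℓ are zeros of (x+a)_ℓ, and those after ℓ are zeros of (x+a+ℓ+1)_{N-ℓ-1}.
  basis-other : ∀ {k ℓ} → k ℕ.< N → k ≢ ℓ → basis ℓ (node k) ≡ 0ℚ
  basis-other {k} {ℓ} k<N k≢ℓ = trans (cong (node k *_) vanish) (*-zeroʳ (node k))
    where
    e = N ∸ ℓ ∸ 1
    vanish : poch (node k + a) ℓ * poch (node k + a + fromℕ ℓ + 1ℚ) e ≡ 0ℚ
    vanish with ℕ.<-cmp k ℓ
    ... | tri< k<ℓ _ _ = trans
      (cong (_* poch (node k + a + fromℕ ℓ + 1ℚ) e)
        (poch-root (node k + a) k<ℓ (trans (cong (_+ fromℕ k) (node+a k)) (+-inverseˡ (fromℕ k)))))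
      (*-zeroˡ (poch (node k + a + fromℕ ℓ + 1ℚ) e))
    ... | tri≈ _ k≡ℓ _ = ⊥-elim (k≢ℓ k≡ℓ)
    ... | tri> _ _ ℓ<k = trans
      (cong (poch (node k + a) ℓ *_) (poch-root (node k + a + fromℕ ℓ + 1ℚ) i<e root))
      (*-zeroʳ (poch (node k + a) ℓ))
      where
      i = k ∸ suc ℓ
      k≡ : suc ℓ ℕ.+ i ≡ k
      k≡ = ℕ.m+[n∸m]≡n ℓ<k
      i<e : i ℕ.< e
      i<e = ℕ.+-cancelˡ-< (suc ℓ) i e
        (subst₂ ℕ._<_ (sym k≡) (sym (suc[k]+[N∸k∸1]≡N (ℕ.<-trans ℓ<k k<N))) k<N)
      root : node k + a + fromℕ ℓ + 1ℚ + fromℕ i ≡ 0ℚ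
      root = begin
        node k + a + fromℕ ℓ + 1ℚ + fromℕ i
          ≡⟨ cong (λ y → y + fromℕ ℓ + 1ℚ + fromℕ i) (node+a k) ⟩
        - fromℕ k + fromℕ ℓ + 1ℚ + fromℕ i
          ≡⟨ solve 3 (λ k l i → :- k :+ l :+ con 1ℚ :+ i := :- k :+ (l :+ con 1ℚ :+ i))
              refl (fromℕ k) (fromℕ ℓ) (fromℕ i) ⟩
        - fromℕ k + (fromℕ ℓ + 1ℚ + fromℕ i)
          ≡⟨ cong (λ y → - fromℕ k + (y + fromℕ i)) (fromℕ-suc ℓ) ⟨
        - fromℕ k + (fromℕ (suc ℓ) + fromℕ i)
          ≡⟨ cong (- fromℕ k +_) (trans (sym (fromℕ-+ (suc ℓ) i)) (cong fromℕ k≡)) ⟩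
        - fromℕ k + fromℕ k                     ≡⟨ +-inverseˡ (fromℕ k) ⟩
        0ℚ                                      ∎

  -- Since x+a = -ℓ at this node, the basis polynomial takes the value -(a+ℓ) (-1)^ℓ ℓ! (N-ℓ-1)!.
  -- The sign and the factorials cancel against `weight` and `multichoose`, and the remaining
  -- factors (a)_ℓ, a+ℓ and (a+ℓ+1)_{N-ℓ-1} combine to (a)_N.
  basis-self : ∀ {ℓ} → ℓ ℕ.< N →
               weight ℓ * multichoose a ℓ * basis ℓ (node ℓ) ≡ poch a N * D (node ℓ)
  basis-self {ℓ} ℓ<N = begin
    weight ℓ * q * (x * (poch (x + a) ℓ * poch (x + a + k + 1ℚ) e))
      ≡⟨ cong₂ (λ u v → weight ℓ * q * (x * (u * v)))
           (trans (cong (λ y → poch y ℓ) (node+a ℓ)) (poch-negative ℓ))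
           (trans (cong (λ y → poch y e) (trans (cong (λ y → y + k + 1ℚ) (node+a ℓ)) (solve 1 (λ k → :- k :+ k :+ con 1ℚ := con 1ℚ)
               refl k))) (poch-1 e)) ⟩
    weight ℓ * q * (x * (s * f * g))
      ≡⟨ cong (λ y → (- 1ℚ) ^ y * v * d * q * (x * (s * f * g))) (ℕ.+-comm ℓ 1) ⟩
    - 1ℚ * s * v * d * q * (- (a + k) * (s * f * g))
      ≡⟨ solve 8 (λ s v d q a k f g → :- con 1ℚ :* s :* v :* d :* q :* (:- (a :+ k) :* (s :* f :* g))
                                 := s :* s :* ((q :* f) :* (a :+ k) :* (v :* g)) :* d) refl s v d q a k f g ⟩
    s * s * (q * f * (a + k) * (v * g)) * d
      ≡⟨ cong (λ y → y * (q * f * (a + k) * (v * g)) * d) (sign² ℓ) ⟩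
    1ℚ * (q * f * (a + k) * (v * g)) * d
      ≡⟨ cong (_* d) (*-identityˡ (q * f * (a + k) * (v * g))) ⟩
    q * f * (a + k) * (v * g) * d
      ≡⟨ cong₂ (λ y z → y * (a + k) * z * d) (÷-*-cancel (poch a ℓ) f {{factorial≢0 ℓ}})
           (÷-*-cancel (poch (a + k + 1ℚ) e) g {{factorial≢0 e}}) ⟩
    poch a (suc ℓ) * poch (a + k + 1ℚ) e * d
      ≡⟨ cong (λ y → poch a (suc ℓ) * poch y e * d) (trans (+-assoc a k 1ℚ) (cong (a +_) (sym (fromℕ-suc ℓ)))) ⟩
    poch a (suc ℓ) * poch (a + fromℕ (suc ℓ)) e * d
      ≡⟨ cong (_* d) (poch-+ a (suc ℓ) e) ⟨
    poch a (suc ℓ ℕ.+ e) * d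
      ≡⟨ cong (λ y → poch a y * d) (suc[k]+[N∸k∸1]≡N ℓ<N) ⟩
    poch a N * d ∎
    where
    e = N ∸ ℓ ∸ 1
    k = fromℕ ℓ
    x = node ℓ
    d = D (node ℓ)
    q = multichoose a ℓ
    v = multichoose (a + k + 1ℚ) e
    s = (- 1ℚ) ^ ℓ
    f = fromℕ (ℓ !)
    g = fromℕ (e !)

  interpolant-node : ∀ (ℓ : Fin N) → interpolant (node (toℕ ℓ)) ≡ poch a N * D (node (toℕ ℓ))
  interpolant-node ℓ = begin
    poch (x + a) N + ∑[ k < N ] (w k * basis (toℕ k) x)
      ≡⟨ cong₂ _+_ (poch-root (x + a) (Fin.toℕ<n ℓ) (trans (cong (_+ fromℕ (toℕ ℓ)) (node+a (toℕ ℓ))) (+-inverseˡ (fromℕ (toℕ ℓ)))))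
           (∑-single (λ k → w k * basis (toℕ k) x) ℓ λ k k≢ℓ →
              trans (cong (w k *_) (basis-other (Fin.toℕ<n ℓ) (λ eq → k≢ℓ (sym (Fin.toℕ-injective eq))))) (*-zeroʳ (w k))) ⟩
    0ℚ + w ℓ * basis (toℕ ℓ) x
      ≡⟨ +-identityˡ (w ℓ * basis (toℕ ℓ) x) ⟩
    w ℓ * basis (toℕ ℓ) x
      ≡⟨ basis-self (Fin.toℕ<n ℓ) ⟩
    poch a N * D x ∎
    where
    x = node (toℕ ℓ)
    w : Fin N → ℚ
    w k = weight (toℕ k) * multichoose a (toℕ k)

  interpolant-0 : interpolant 0ℚ ≡ poch a N * D 0ℚ
  interpolant-0 = begin
    poch (0ℚ + a) N + ∑[ ℓ < N ] (w ℓ * basis (toℕ ℓ) 0ℚ)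
      ≡⟨ cong₂ _+_ (cong (λ y → poch y N) (+-identityˡ a))
           (∑-zero {N} (λ ℓ → w ℓ * basis (toℕ ℓ) 0ℚ) λ ℓ → trans (cong (w ℓ *_) (*-zeroˡ (b ℓ))) (*-zeroʳ (w ℓ))) ⟩
    poch a N + 0ℚ        ≡⟨ +-identityʳ (poch a N) ⟩
    poch a N             ≡⟨ *-identityʳ (poch a N) ⟨
    poch a N * 1ℚ        ≡⟨ cong (poch a N *_) D[0]≡1 ⟨
    poch a N * D 0ℚ      ∎
    where
    w b : Fin N → ℚ
    w ℓ = weight (toℕ ℓ) * multichoose a (toℕ ℓ)
    b ℓ = poch (0ℚ + a) (toℕ ℓ) * poch (0ℚ + a + fromℕ (toℕ ℓ) + 1ℚ) (N ∸ toℕ ℓ ∸ 1)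

  -- Both sides have degree at most N and agree at N + 1 points; a > 0 keeps the point 0 apart from
  -- the others.
  interpolant≡ : ∀ x → interpolant x ≡ poch a N * D x
  interpolant≡ x = x-y≡0⇒x≡y (interpolant x) (poch a N * D x) $
    Polynomial-zero N {λ x → interpolant x - poch a N * D x}
      (Polynomial-+ N polynomial-interpolant
        (Polynomial-resp-≗ N (λ x → solve 2 (λ p d → :- p :* d := :- (p :* d))
            refl (poch a N) (D x))
          (Polynomial-scale N (- poch a N) polynomial-D)))
      z z-injective z-zero x
    where
    z : Fin (suc N) → ℚ
    z zero    = 0ℚ
    z (suc ℓ) = node (toℕ ℓ)
    -node : ∀ ℓ → - node ℓ ≡ a + fromℕ ℓ
    -node ℓ = solve 1 (λ y → :- (:- y) := y) refl (a + fromℕ ℓ)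
    node≢0 : ∀ ℓ → node ℓ ≢ 0ℚ
    node≢0 ℓ eq = >0⇒≢0 (x+n>0 a>0 ℓ) (trans (sym (-node ℓ)) (cong -_ eq))
    z-injective : Injective _≡_ _≡_ z
    z-injective {zero}  {zero}  eq = refl
    z-injective {zero}  {suc ℓ} eq = ⊥-elim (node≢0 (toℕ ℓ) (sym eq))
    z-injective {suc k} {zero}  eq = ⊥-elim (node≢0 (toℕ k) eq)
    z-injective {suc k} {suc ℓ} eq = cong suc (Fin.toℕ-injective (fromℕ-injective (begin
      fromℕ (toℕ k)        ≡⟨ solve 2 (λ a k → k := :- (:- (a :+ k)) :- a) refl a (fromℕ (toℕ k)) ⟩
      - node (toℕ k) - a   ≡⟨ cong (λ y → - y - a) eq ⟩
      - node (toℕ ℓ) - a   ≡⟨ solve 2 (λ a k → :- (:- (a :+ k)) :- a := k) refl a (fromℕ (toℕ ℓ)) ⟩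
      fromℕ (toℕ ℓ)        ∎)))
    z-zero : ∀ i → interpolant (z i) - poch a N * D (z i) ≡ 0ℚ
    z-zero zero    = trans (cong (_- poch a N * D 0ℚ) interpolant-0) (+-inverseʳ (poch a N * D 0ℚ))
    z-zero (suc ℓ) = trans (cong (_- poch a N * D (node (toℕ ℓ))) (interpolant-node ℓ)) (+-inverseʳ (poch a N * D (node (toℕ ℓ))))

  -- The formula for a_{N-k-1} with the product over j abstracted to a value of `D`.
  coefficient : ℕ → ℚ
  coefficient k = ∑from k N λ ℓ →
    (- 1ℚ) ^ (ℓ ℕ.+ 1) * multichoose (a - 1ℚ) (ℓ ∸ k)
      * multichoose (a + fromℕ ℓ + 1ℚ) (N ∸ ℓ ∸ 1) * D (node ℓ)

  -- The left side is R(x) with its k = 0 term split off. After exchanging the two summations, the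
  -- inner sum for fixed ℓ is the Saalschütz sum at y = x+1, which gives (x+a)_ℓ (a)_ℓ/ℓ!; the
  -- factors taken out of it complete this to `basis ℓ x`.
  expansion : ∀ x →
    poch (x + a) N
      + ∑[ i < N ] (coefficient (toℕ i) * (poch x (suc (toℕ i)) * poch (x + a + fromℕ (suc (toℕ i))) (N ∸ suc (toℕ i))))
    ≡ poch a N * D x
  expansion x = trans (cong (poch (x + a) N +_) collect) (interpolant≡ x)
    where
    A : ℕ → ℚ
    A k = poch x (suc k) * poch (x + a + fromℕ (suc k)) (N ∸ suc k)
    h : ℕ → ℕ → ℚ
    h k ℓ = (- 1ℚ) ^ (ℓ ℕ.+ 1) * multichoose (a - 1ℚ) (ℓ ∸ k)
      * multichoose (a + fromℕ ℓ + 1ℚ) (N ∸ ℓ ∸ 1) * D (node ℓ)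
    t : ℕ → ℕ → ℚ
    t ℓ k = multichoose (a - 1ℚ) (ℓ ∸ k) * (poch (x + 1ℚ) k * poch (x + 1ℚ + a + fromℕ k) (ℓ ∸ k))
    tail : ℕ → ℚ
    tail ℓ = poch (x + a + fromℕ ℓ + 1ℚ) (N ∸ ℓ ∸ 1)
    -- The factors x+a+k+1, ..., x+a+N-1 are cut after x+a+ℓ. Those beyond the cut form `tail ℓ`,
    -- which is independent of k and can leave the sum over k.
    A≡ : ∀ {k ℓ} → k ℕ.≤ ℓ → ℓ ℕ.< N →
         A k ≡ x * (poch (x + 1ℚ) k * poch (x + 1ℚ + a + fromℕ k) (ℓ ∸ k)) * tail ℓ
    A≡ {k} {ℓ} k≤ℓ ℓ<N = begin
      poch x (suc k) * poch (x + a + fromℕ (suc k)) (N ∸ suc k)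
        ≡⟨ cong₂ (λ u v → u * poch (x + a + fromℕ (suc k)) v) (poch-front x k) N∸1+k ⟩
      x * poch (x + 1ℚ) k * poch (x + a + fromℕ (suc k)) ((ℓ ∸ k) ℕ.+ e)
        ≡⟨ cong (x * poch (x + 1ℚ) k *_) (poch-+ (x + a + fromℕ (suc k)) (ℓ ∸ k) e) ⟩
      x * poch (x + 1ℚ) k * (poch (x + a + fromℕ (suc k)) (ℓ ∸ k) * poch (x + a + fromℕ (suc k) + fromℕ (ℓ ∸ k)) e)
        ≡⟨ cong₂ (λ u v → x * poch (x + 1ℚ) k * (poch u (ℓ ∸ k) * poch v e)) shift₁ shift₂ ⟩
      x * poch (x + 1ℚ) k * (poch (x + 1ℚ + a + fromℕ k) (ℓ ∸ k) * tail ℓ)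
        ≡⟨ solve 4 (λ x p q r → x :* p :* (q :* r) := x :* (p :* q) :* r)
            refl x (poch (x + 1ℚ) k) (poch (x + 1ℚ + a + fromℕ k) (ℓ ∸ k)) (tail ℓ) ⟩
      x * (poch (x + 1ℚ) k * poch (x + 1ℚ + a + fromℕ k) (ℓ ∸ k)) * tail ℓ ∎
      where
      e = N ∸ ℓ ∸ 1
      N∸1+k : N ∸ suc k ≡ (ℓ ∸ k) ℕ.+ e
      N∸1+k = ℕ.+-cancelˡ-≡ (suc k) (N ∸ suc k) ((ℓ ∸ k) ℕ.+ e) (trans
        (ℕ.m+[n∸m]≡n (ℕ.≤-<-trans k≤ℓ ℓ<N))
        (sym (trans (sym (ℕ.+-assoc (suc k) (ℓ ∸ k) e))
          (trans (cong (λ y → suc y ℕ.+ e) (ℕ.m+[n∸m]≡n k≤ℓ)) (suc[k]+[N∸k∸1]≡N ℓ<N)))))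
      shift₁ : x + a + fromℕ (suc k) ≡ x + 1ℚ + a + fromℕ k
      shift₁ = trans (cong (x + a +_) (fromℕ-suc k))
        (solve 3 (λ x a k → x :+ a :+ (k :+ con 1ℚ) := x :+ con 1ℚ :+ a :+ k) refl x a (fromℕ k))
      shift₂ : x + a + fromℕ (suc k) + fromℕ (ℓ ∸ k) ≡ x + a + fromℕ ℓ + 1ℚ
      shift₂ = begin
        x + a + fromℕ (suc k) + fromℕ (ℓ ∸ k)
          ≡⟨ +-assoc (x + a) (fromℕ (suc k)) (fromℕ (ℓ ∸ k)) ⟩
        x + a + (fromℕ (suc k) + fromℕ (ℓ ∸ k))  ≡⟨ cong (x + a +_) (fromℕ-+ (suc k) (ℓ ∸ k)) ⟨
        x + a + fromℕ (suc (k ℕ.+ (ℓ ∸ k)))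
          ≡⟨ cong (λ y → x + a + fromℕ (suc y)) (ℕ.m+[n∸m]≡n k≤ℓ) ⟩
        x + a + fromℕ (suc ℓ)                    ≡⟨ cong (x + a +_) (fromℕ-suc ℓ) ⟩
        x + a + (fromℕ ℓ + 1ℚ)                   ≡⟨ +-assoc (x + a) (fromℕ ℓ) 1ℚ ⟨
        x + a + fromℕ ℓ + 1ℚ                     ∎
    summand : ∀ {k ℓ} → k ℕ.≤ ℓ → ℓ ℕ.< N →
              h k ℓ * A k ≡ weight ℓ * x * tail ℓ * t ℓ k
    summand {k} {ℓ} k≤ℓ ℓ<N = trans (cong (h k ℓ *_) (A≡ k≤ℓ ℓ<N))
      (solve 7 (λ s p v d x u w → s :* p :* v :* d :* (x :* u :* w) := s :* v :* d :* x :* w :* (p :* u)) refl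
        ((- 1ℚ) ^ (ℓ ℕ.+ 1)) (multichoose (a - 1ℚ) (ℓ ∸ k)) (multichoose (a + fromℕ ℓ + 1ℚ) (N ∸ ℓ ∸ 1)) (D (node ℓ))
        x (poch (x + 1ℚ) k * poch (x + 1ℚ + a + fromℕ k) (ℓ ∸ k)) (tail ℓ))
    inner : ∀ {ℓ} → ℓ ℕ.< N →
            ∑[ k ≤ ℓ ] (h (toℕ k) ℓ * A (toℕ k)) ≡ weight ℓ * multichoose a ℓ * basis ℓ x
    inner {ℓ} ℓ<N = begin
      ∑[ k ≤ ℓ ] (h (toℕ k) ℓ * A (toℕ k))
        ≡⟨ sum-cong-≗ {suc ℓ} (λ k → summand (Fin.toℕ≤pred[n] k) ℓ<N) ⟩
      ∑[ k ≤ ℓ ] (w * x * tail ℓ * t ℓ (toℕ k))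
        ≡⟨ *-distribˡ-sum {suc ℓ} (w * x * tail ℓ) (t ℓ ∘ toℕ) ⟨
      w * x * tail ℓ * ∑[ k ≤ ℓ ] t ℓ (toℕ k)
        ≡⟨ cong (w * x * tail ℓ *_) (∑-multichoose-poch a ℓ (x + 1ℚ)) ⟩
      w * x * tail ℓ * (poch (x + 1ℚ + a - 1ℚ) ℓ * q)
        ≡⟨ cong (λ y → w * x * tail ℓ * (poch y ℓ * q)) (solve 2 (λ x a → x :+ con 1ℚ :+ a :- con 1ℚ := x :+ a)
            refl x a) ⟩
      w * x * tail ℓ * (poch (x + a) ℓ * q)
        ≡⟨ solve 5 (λ w x t p q → w :* x :* t :* (p :* q) := w :* q :* (x :* (p :* t)))
            refl w x (tail ℓ) (poch (x + a) ℓ) q ⟩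
      w * q * basis ℓ x ∎
      where
      w = weight ℓ
      q = multichoose a ℓ
    collect : ∑[ i < N ] (coefficient (toℕ i) * A (toℕ i))
              ≡ ∑[ ℓ < N ] (weight (toℕ ℓ) * multichoose a (toℕ ℓ) * basis (toℕ ℓ) x)
    collect = begin
      ∑[ i < N ] (coefficient (toℕ i) * A (toℕ i))
        ≡⟨ sum-cong-≗ {N} (λ i → *-distribʳ-sum {N ∸ toℕ i} (A (toℕ i)) (λ j → h (toℕ i) (toℕ i ℕ.+ toℕ j))) ⟩
      ∑[ i < N ] ∑from (toℕ i) N (λ ℓ → h (toℕ i) ℓ * A (toℕ i))
        ≡⟨ ∑-triangle N (λ k ℓ → h k ℓ * A k) ⟩
      ∑[ ℓ < N ] ∑[ k ≤ toℕ ℓ ] (h (toℕ k) (toℕ ℓ) * A (toℕ k))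
        ≡⟨ sum-cong-≗ {N} (λ ℓ → inner (Fin.toℕ<n ℓ)) ⟩
      ∑[ ℓ < N ] (weight (toℕ ℓ) * multichoose a (toℕ ℓ) * basis (toℕ ℓ) x) ∎

-- The Padé approximants

polynomial-≤ : ∀ {d} c {k} → k ℕ.≤ d → polynomial d c k ≡ c k
polynomial-≤ {d} c {k} k≤d with k ℕ.≤? d
... | yes _   = refl
... | no  k≰d = ⊥-elim (k≰d k≤d)

polynomial-> : ∀ {d} c {k} → d ℕ.< k → polynomial d c k ≡ 0ℚ
polynomial-> {d} c {k} d<k with k ℕ.≤? d
... | yes k≤d = ⊥-elim (ℕ.<⇒≱ d<k k≤d)
... | no  _   = refl

module _ {m : ℕ}
  (α₀ : ℚ) (α : Fin m → ℚ) (α₀>0 : 0ℚ < α₀) (α>0 : ∀ j → 0ℚ < α j)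
  (n Ns : Fin m → ℕ) (N∸1≤Ns : ∀ j → ∑ℕ n ∸ 1 ℕ.≤ Ns j)
  where

  open Approximants α₀ α α₀>0 α>0 n Ns N∸1≤Ns

  N≤1+Ns : ∀ j → N ℕ.≤ suc (Ns j)
  N≤1+Ns j = ℕ.≤-trans (ℕ.m≤n+m∸n N 1) (s≤s (N∸1≤Ns j))

  -- Matching on k <? N with reversed in the goal would normalise its sums and
  -- products, so the branches of a are first collected in a separate function.
  a-cases : ∀ {k} → Dec (k ℕ.< N) → ℚ
  a-cases {k} (yes _) = reversed (N ∸ k ∸ 1)
  a-cases     (no _)  = 1ℚ

  a≡a-cases : ∀ k → a k ≡ a-cases (k ℕ.<? N)
  a≡a-cases k with k ℕ.<? N
  ... | yes _ = refl
  ... | no  _ = refl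

  a-< : ∀ {i} → i ℕ.< N → a (N ∸ suc i) ≡ reversed i
  a-< {i} i<N = begin
    a k                           ≡⟨ a≡a-cases k ⟩
    a-cases (k ℕ.<? N)            ≡⟨ cong a-cases (proj₂ (dec-yes (k ℕ.<? N) k<N)) ⟩
    reversed (N ∸ k ∸ 1)          ≡⟨ cong (λ y → reversed (y ∸ 1)) (ℕ.m∸[m∸n]≡n i<N) ⟩
    reversed i                    ∎
    where
    k = N ∸ suc i
    k<N : k ℕ.< N
    k<N = ℕ.∸-monoʳ-< {N} {suc i} {0} (s≤s z≤n) i<N

  a-N : a N ≡ 1ℚ
  a-N = trans (a≡a-cases N) (cong a-cases (dec-no (N ℕ.<? N) (ℕ.<-irrefl refl)))

  -- `Q` vanishes beyond degree N, which accounts for the bound min(N, μ) in `c`. So `P j` is the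
  -- truncation of the product at degree N_j, and only coefficients beyond N_j remain to be treated.
  Qφ≡c : ∀ j μ → (Q ⊛ φ j) μ ≡ c j μ
  Qφ≡c j μ = begin
    ∑[ k ≤ μ ] (Q (toℕ k) * φ j (μ ∸ toℕ k))
      ≡⟨ ∑-truncate (λ k → Q k * φ j (μ ∸ k)) (s≤s (ℕ.m⊓n≤n N μ)) truncated ⟩
    ∑[ k ≤ N ℕ.⊓ μ ] (Q (toℕ k) * φ j (μ ∸ toℕ k))
      ≡⟨ sum-cong-≗ {suc (N ℕ.⊓ μ)} (λ k → cong (_* φ j (μ ∸ toℕ k))
           (polynomial-≤ a (ℕ.≤-trans (Fin.toℕ≤pred[n] k) (ℕ.m⊓n≤m N μ)))) ⟩
    c j μ ∎
    where
    truncated : ∀ {k} → suc (N ℕ.⊓ μ) ℕ.≤ k → k ℕ.< suc μ → Q k * φ j (μ ∸ k) ≡ 0ℚ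
    truncated {k} N⊓μ<k k≤μ = trans
      (cong (_* φ j (μ ∸ k)) (polynomial-> a (ℕ.≰⇒> λ k≤N → ℕ.<⇒≱ N⊓μ<k (ℕ.⊓-glb k≤N (ℕ.≤-pred k≤μ)))))
      (*-zeroˡ (φ j (μ ∸ k)))

  -- The value of x = α_j + μ - N at μ = N_j + 1, the first coefficient that has to vanish.
  B : Fin m → ℚ
  B j = α j + fromℕ (Ns j) - fromℕ N + 1ℚ

  poch-B≢0 : ∀ j → NonZero (poch (B j) (n j))
  poch-B≢0 j = poch≢0 (shift>0 (α>0 j) N (Ns j) (N∸1≤Ns j)) (n j)

  -- Its zeros B_j, B_j + 1, ..., B_j + n_j - 1 are the values of x for the n_j coefficients that
  -- have to vanish; the divisor normalises it to 1 at x = 0.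
  D-factor : Fin m → ℚ → ℚ
  D-factor j x = (poch (B j - x) (n j) ÷ poch (B j) (n j)) {{poch-B≢0 j}}

  D : ℚ → ℚ
  D x = ∏ λ j → D-factor j x

  polynomial-D : Polynomial N D
  polynomial-D = Polynomial-∏ n D-factor λ j →
    let i = (1/ poch (B j) (n j)) {{poch-B≢0 j}} in
    Polynomial-resp-≗ (n j)
      (λ x → trans (*-comm i (poch (- 1ℚ * x + B j) (n j)))
        (cong (λ y → poch y (n j) * i) (solve 2 (λ x b → :- con 1ℚ :* x :+ b := b :- x)
            refl x (B j))))
      (Polynomial-scale (n j) i (Polynomial-poch (- 1ℚ) (B j) (n j)))

  D[0]≡1 : D 0ℚ ≡ 1ℚ
  D[0]≡1 = ∏-one (λ j → D-factor j 0ℚ) λ j → trans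
    (cong (λ y → poch y (n j) * (1/ poch (B j) (n j)) {{poch-B≢0 j}}) (+-identityʳ (B j)))
    (*-inverseʳ (poch (B j) (n j)) {{poch-B≢0 j}})

  open Interpolation α₀ α₀>0 N D polynomial-D D[0]≡1 using (node; coefficient; expansion)

  -- The numerators in the definition of `a` are those of `D` at -α₀-ℓ, because B_j - (-α₀-ℓ) = α_j
  -- + α₀ + N_j - N + ℓ + 1.
  reversed≡coefficient : ∀ k → reversed k ≡ coefficient k
  reversed≡coefficient k = sum-cong-≗ {N ∸ k} λ i →
    let ℓ = k ℕ.+ toℕ i in
    cong ((- 1ℚ) ^ (ℓ ℕ.+ 1) * multichoose (α₀ - 1ℚ) (ℓ ∸ k)
            * multichoose (α₀ + fromℕ ℓ + 1ℚ) (N ∸ ℓ ∸ 1) *_)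
      (∏-cong-≗ λ j → cong (λ y → poch y (n j) * (1/ poch (B j) (n j)) {{poch-B≢0 j}})
        (solve 5 (λ a a₀ M N l → a :+ a₀ :+ M :- N :+ l :+ con 1ℚ := a :+ M :- N :+ con 1ℚ :- (:- (a₀ :+ l)))
          refl (α j) α₀ (fromℕ (Ns j)) (fromℕ N) (fromℕ ℓ)))

  D-root : ∀ j i → i ℕ.< n j → ∀ x → B j - x + fromℕ i ≡ 0ℚ → D x ≡ 0ℚ
  D-root j i i<n x eq = ∏-zero (λ j → D-factor j x) j
    (trans (cong (_* inv) (poch-root (B j - x) i<n eq)) (*-zeroˡ inv))
    where inv = (1/ poch (B j) (n j)) {{poch-B≢0 j}}

  -- (α_j+α₀)_{r+N} is a common denominator of the coefficients of φ_j from r to r+N. Splitting it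
  -- at r+k cancels the denominator, and splitting (α_j)_{r+k} at r isolates a factor independent of
  -- k.
  φ-* : ∀ j r {k} → k ℕ.≤ N → let x = α j + fromℕ r in
        φ j (r ℕ.+ k) * poch (α j + α₀) (r ℕ.+ N)
        ≡ poch (α j) r * (poch x k * poch (x + α₀ + fromℕ k) (N ∸ k))
  φ-* j r {k} k≤N = begin
    φ j (r ℕ.+ k) * poch b (r ℕ.+ N)
      ≡⟨ cong (λ y → φ j (r ℕ.+ k) * poch b y) (trans (cong (r ℕ.+_) (sym (ℕ.m+[n∸m]≡n k≤N))) (sym (ℕ.+-assoc r k (N ∸ k)))) ⟩
    φ j (r ℕ.+ k) * poch b (r ℕ.+ k ℕ.+ (N ∸ k))
      ≡⟨ cong (φ j (r ℕ.+ k) *_) (poch-+ b (r ℕ.+ k) (N ∸ k)) ⟩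
    φ j (r ℕ.+ k) * (poch b (r ℕ.+ k) * poch (b + fromℕ (r ℕ.+ k)) (N ∸ k))
      ≡⟨ *-assoc (φ j (r ℕ.+ k)) (poch b (r ℕ.+ k)) (poch (b + fromℕ (r ℕ.+ k)) (N ∸ k)) ⟨
    φ j (r ℕ.+ k) * poch b (r ℕ.+ k) * poch (b + fromℕ (r ℕ.+ k)) (N ∸ k)
      ≡⟨ cong₂ (λ u v → u * poch v (N ∸ k))
           (÷-*-cancel (poch (α j) (r ℕ.+ k)) (poch b (r ℕ.+ k)) {{poch≢0 (x+y>0 (α>0 j) α₀>0) (r ℕ.+ k)}}) shift ⟩
    poch (α j) (r ℕ.+ k) * poch (x + α₀ + fromℕ k) (N ∸ k)
      ≡⟨ cong (_* poch (x + α₀ + fromℕ k) (N ∸ k)) (poch-+ (α j) r k) ⟩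
    poch (α j) r * poch x k * poch (x + α₀ + fromℕ k) (N ∸ k)
      ≡⟨ *-assoc (poch (α j) r) (poch x k) (poch (x + α₀ + fromℕ k) (N ∸ k)) ⟩
    poch (α j) r * (poch x k * poch (x + α₀ + fromℕ k) (N ∸ k)) ∎
    where
    x = α j + fromℕ r
    b = α j + α₀
    shift : b + fromℕ (r ℕ.+ k) ≡ x + α₀ + fromℕ k
    shift = trans (cong (b +_) (fromℕ-+ r k))
      (solve 4 (λ a a₀ r k → a :+ a₀ :+ (r :+ k) := a :+ r :+ a₀ :+ k)
          refl (α j) α₀ (fromℕ r) (fromℕ k))

  -- Writing μ as r + N replaces μ - N by a natural number and makes min(N, μ) equal to N. Reversing
  -- the summation then produces the left side of `expansion` at x = α_j + r, whose leading term
  -- comes from a_N = 1.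
  c-* : ∀ j r → c j (r ℕ.+ N) * poch (α j + α₀) (r ℕ.+ N)
                ≡ poch (α j) r * (poch α₀ N * D (α j + fromℕ r))
  c-* j r = begin
    c j (r ℕ.+ N) * p
      ≡⟨ cong (λ d → ∑[ k ≤ d ] (a (toℕ k) * φ j (r ℕ.+ N ∸ toℕ k)) * p) (ℕ.m≤n⇒m⊓n≡m (ℕ.m≤n+m N r)) ⟩
    ∑[ k ≤ N ] (a (toℕ k) * φ j (r ℕ.+ N ∸ toℕ k)) * p
      ≡⟨ cong (_* p) (∑-reverse N (λ k → a k * φ j (r ℕ.+ N ∸ k))) ⟩
    ∑[ k ≤ N ] (a (N ∸ toℕ k) * φ j (r ℕ.+ N ∸ (N ∸ toℕ k))) * p
      ≡⟨ *-distribʳ-sum {suc N} p (λ k → a (N ∸ toℕ k) * φ j (r ℕ.+ N ∸ (N ∸ toℕ k))) ⟩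
    ∑[ k ≤ N ] (a (N ∸ toℕ k) * φ j (r ℕ.+ N ∸ (N ∸ toℕ k)) * p)
      ≡⟨ sum-cong-≗ {suc N} (λ k → summand (Fin.toℕ≤pred[n] k)) ⟩
    ∑[ k ≤ N ] (poch (α j) r * (a (N ∸ toℕ k) * t (toℕ k)))
      ≡⟨ *-distribˡ-sum {suc N} (poch (α j) r) (λ k → a (N ∸ toℕ k) * t (toℕ k)) ⟨
    poch (α j) r * (a N * t 0 + ∑[ i < N ] (a (N ∸ suc (toℕ i)) * t (suc (toℕ i))))
      ≡⟨ cong (poch (α j) r *_) (cong₂ _+_ head
           (sum-cong-≗ {N} λ i → cong (_* t (suc (toℕ i))) (trans (a-< (Fin.toℕ<n i)) (reversed≡coefficient (toℕ i))))) ⟩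
    poch (α j) r * (poch (x + α₀) N + ∑[ i < N ] (coefficient (toℕ i) * t (suc (toℕ i))))
      ≡⟨ cong (poch (α j) r *_) (expansion x) ⟩
    poch (α j) r * (poch α₀ N * D x) ∎
    where
    p = poch (α j + α₀) (r ℕ.+ N)
    x = α j + fromℕ r
    t : ℕ → ℚ
    t k = poch x k * poch (x + α₀ + fromℕ k) (N ∸ k)
    head : a N * t 0 ≡ poch (x + α₀) N
    head = trans (cong₂ (λ u v → u * (1ℚ * poch v N)) a-N (+-identityʳ (x + α₀)))
      (trans (*-identityˡ (1ℚ * poch (x + α₀) N)) (*-identityˡ (poch (x + α₀) N)))
    index : ∀ {k} → k ℕ.≤ N → r ℕ.+ N ∸ (N ∸ k) ≡ r ℕ.+ k
    index {k} k≤N = trans (ℕ.+-∸-assoc r (ℕ.m∸n≤m N k)) (cong (r ℕ.+_) (ℕ.m∸[m∸n]≡n k≤N))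
    summand : ∀ {k} → k ℕ.≤ N →
      a (N ∸ k) * φ j (r ℕ.+ N ∸ (N ∸ k)) * p ≡ poch (α j) r * (a (N ∸ k) * t k)
    summand {k} k≤N = begin
      a (N ∸ k) * φ j (r ℕ.+ N ∸ (N ∸ k)) * p   ≡⟨ cong (λ y → a (N ∸ k) * φ j y * p) (index k≤N) ⟩
      a (N ∸ k) * φ j (r ℕ.+ k) * p             ≡⟨ *-assoc (a (N ∸ k)) (φ j (r ℕ.+ k)) p ⟩
      a (N ∸ k) * (φ j (r ℕ.+ k) * p)           ≡⟨ cong (a (N ∸ k) *_) (φ-* j r k≤N) ⟩
      a (N ∸ k) * (poch (α j) r * t k)
        ≡⟨ solve 3 (λ a p t → a :* (p :* t) := p :* (a :* t))
            refl (a (N ∸ k)) (poch (α j) r) (t k) ⟩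
      poch (α j) r * (a (N ∸ k) * t k)          ∎

  -- For μ = N_j + 1 + i with i < n_j one has x = B_j + i, a zero of the j-th factor of `D`. The
  -- bound N_j ≥ N - 1 ensures μ ≥ N, so that `c-*` applies with r = μ - N.
  c≡0 : ∀ j μ → Ns j ℕ.< μ → μ ℕ.< Ns j ℕ.+ n j ℕ.+ 1 → c j μ ≡ 0ℚ
  c≡0 j μ Ns<μ μ< = subst (λ μ → c j μ ≡ 0ℚ) r+N≡μ
    (x*y≡0⇒y≡0 p {{poch≢0 (x+y>0 (α>0 j) α₀>0) (r ℕ.+ N)}} (begin
      p * c j (r ℕ.+ N)                 ≡⟨ *-comm p (c j (r ℕ.+ N)) ⟩
      c j (r ℕ.+ N) * p                 ≡⟨ c-* j r ⟩
      poch (α j) r * (poch α₀ N * D x)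
        ≡⟨ cong (λ y → poch (α j) r * (poch α₀ N * y)) (D-root j i i<n x root) ⟩
      poch (α j) r * (poch α₀ N * 0ℚ)
        ≡⟨ solve 2 (λ a b → a :* (b :* con 0ℚ) := con 0ℚ) refl (poch (α j) r) (poch α₀ N) ⟩
      0ℚ ∎))
    where
    r = μ ∸ N
    i = μ ∸ suc (Ns j)
    p = poch (α j + α₀) (r ℕ.+ N)
    x = α j + fromℕ r
    r+N≡μ : r ℕ.+ N ≡ μ
    r+N≡μ = ℕ.m∸n+n≡m (ℕ.≤-trans (N≤1+Ns j) Ns<μ)
    1+Ns+i≡μ : suc (Ns j) ℕ.+ i ≡ μ
    1+Ns+i≡μ = ℕ.m+[n∸m]≡n Ns<μ
    i<n : i ℕ.< n j
    i<n = ℕ.+-cancelˡ-< (suc (Ns j)) i (n j)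
      (subst₂ ℕ._<_ (sym 1+Ns+i≡μ) (ℕ.+-comm (Ns j ℕ.+ n j) 1) μ<)
    root : B j - x + fromℕ i ≡ 0ℚ
    root = begin
      α j + M - fromℕ N + 1ℚ - (α j + fromℕ r) + fromℕ i
        ≡⟨ solve 5 (λ a M N r i → a :+ M :- N :+ con 1ℚ :- (a :+ r) :+ i := M :+ con 1ℚ :+ i :- (r :+ N))
            refl (α j) M (fromℕ N) (fromℕ r) (fromℕ i) ⟩
      M + 1ℚ + fromℕ i - (fromℕ r + fromℕ N)
        ≡⟨ cong₂ (λ u v → u + fromℕ i - v) (fromℕ-suc (Ns j)) (fromℕ-+ r N) ⟨
      fromℕ (suc (Ns j)) + fromℕ i - fromℕ (r ℕ.+ N)
        ≡⟨ cong (_- fromℕ (r ℕ.+ N)) (fromℕ-+ (suc (Ns j)) i) ⟨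
      fromℕ (suc (Ns j) ℕ.+ i) - fromℕ (r ℕ.+ N)
        ≡⟨ cong₂ (λ u v → fromℕ u - fromℕ v) 1+Ns+i≡μ r+N≡μ ⟩
      fromℕ μ - fromℕ μ
        ≡⟨ +-inverseʳ (fromℕ μ) ⟩
      0ℚ ∎
      where M = fromℕ (Ns j)

  padé : IsPadéSecondKind φ N Ns n Q P
  padé = record
    { Q≢0     = λ Q≡0 → 1≢0 (trans (sym a-N) (trans (sym (polynomial-≤ a ℕ.≤-refl)) (Q≡0 N)))
    ; degreeQ = λ μ → polynomial-> a
    ; degreeP = λ j μ → polynomial-> (c j)
    ; order   = order
    }
    where
    order : ∀ j → Order≥ (Ns j ℕ.+ n j ℕ.+ 1) (Q ⊛ φ j ⊖ P j)
    order j μ μ< with ℕ.≤-<-connex μ (Ns j)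
    ... | inj₁ μ≤Ns = trans (cong₂ _-_ (Qφ≡c j μ) (polynomial-≤ (c j) μ≤Ns)) (+-inverseʳ (c j μ))
    ... | inj₂ Ns<μ = trans (cong₂ _-_ (trans (Qφ≡c j μ) (c≡0 j μ Ns<μ μ<)) (polynomial-> (c j) Ns<μ)) refl

theorem1 : (m : ℕ) → 1 ℕ.≤ m →
    (α₀ : ℚ) (α : Fin m → ℚ) →
    (α₀>0 : 0ℚ < α₀) (α>0 : ∀ j → 0ℚ < α j) →
    (∀ i j → i Fin.< j → ∀ (z : ℤ) → α i - α j ≢ fromℤ z) →
    (n : Fin m → ℕ) → (∀ j → 1 ℕ.≤ n j) →
    (Ns : Fin m → ℕ) → (∀ j → 1 ℕ.≤ Ns j) →
    (N∸1≤Ns : ∀ j → ∑ℕ n ∸ 1 ℕ.≤ Ns j) →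
    let open Approximants α₀ α α₀>0 α>0 n Ns N∸1≤Ns in
    IsPadéSecondKind φ N Ns n Q P
theorem1 m _ α₀ α α₀>0 α>0 _ n _ Ns _ N∸1≤Ns = padé α₀ α α₀>0 α>0 n Ns N∸1≤Ns
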